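{- For every nonnegative integer $m$, the number of partitions of $2m$ whose principal hooks are all even equals the number of overpartitions of $m$.
   Context: The principal hooks of a partition are the hooks of the cells on the main diagonal of its Young diagram; a principal hook is even if its hook length is even. An overpartition is a partition in which the first occurrence of each distinct part may be overlined. -}

module Defs where

open import Data.Bool.Base using (Bool; T)
open import Data.Fin.Base using (Fin)
open import Data.List.Base using (List; []; _∷_; filter; length; map; sum)
open import Data.List.Relation.Unary.All using (All)
open import Data.List.Relation.Unary.AllPairs using (AllPairs)
open import Data.List.Relation.Unary.Linked using (Linked)
open import Data.Nat.Base using (ℕ; zero; suc; _+_; _∸_; _<_; _≥_)
open import Data.Nat.Divisibility using (_∣_)
open import Data.Nat.Properties using (_<?_)
open import Data.Product.Base using (_×_; proj₁; proj₂)
open import Data.Refinement using (Refinement-syntax)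
open import Function.Bundles using (_↔_)
open import Relation.Binary.PropositionalEquality using (_≢_; _≡_)

record IsPartition (n : ℕ) (ps : List ℕ) : Set where
  field
    decreasing : Linked _≥_ ps
    positive   : All (0 <_) ps
    total      : sum ps ≡ n

-- Rows and columns of Young diagrams are numbered from 0, in English
-- notation; rows below the diagram have length 0.
row : List ℕ → ℕ → ℕ
row []       _       = 0
row (p ∷ _)  zero    = p
row (_ ∷ ps) (suc i) = row ps i

col : List ℕ → ℕ → ℕ
col ps j = length (filter (j <?_) ps)

IsCell : List ℕ → ℕ → ℕ → Set
IsCell ps i j = j < row ps i

-- The hook of (i , j) is the cell itself together with the cells to its right
-- (arm) and the cells below it (leg). Meaningful only when IsCell ps i j,
-- where neither truncated subtraction truncates.
hookLength : List ℕ → ℕ → ℕ → ℕ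
hookLength ps i j = arm + leg + 1
  where
  arm leg : ℕ
  arm = row ps i ∸ suc j
  leg = col ps j ∸ suc i

EvenPrincipalHooks : List ℕ → Set
EvenPrincipalHooks ps = ∀ i → IsCell ps i i → 2 ∣ hookLength ps i i

-- An entry (p , b) is a part p, overlined exactly when b is true. An overlined
-- part must differ from every part listed before it, i.e. be the first
-- occurrence of its value.
record IsOverpartition (n : ℕ) (os : List (ℕ × Bool)) : Set where
  field
    partition : IsPartition n (map proj₁ os)
    overlines : AllPairs (λ x y → T (proj₂ y) → proj₁ x ≢ proj₁ y) os

-- Proofs in refinement types are irrelevant, so that equality of elements, and
-- hence counting, only concerns the underlying lists.
EvenHookPartition : ℕ → Set
EvenHookPartition n = [ ps ∈ List ℕ ∣ (IsPartition n ps × EvenPrincipalHooks ps) ]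

Overpartition : ℕ → Set
Overpartition n = [ os ∈ List (ℕ × Bool) ∣ IsOverpartition n os ]

HasCardinality : Set → ℕ → Set
HasCardinality A k = A ↔ Fin k

{-# OPTIONS --safe #-}
module Submission where

-- When the principal hooks are all even, removing the outermost one lowers the
-- number of columns and the number of rows by amounts of the same parity, except
-- that the two parities differ when only one hook is left. Recording these
-- parities and the halved amounts turns the partitions in question into free
-- lists of triples (s , u , v). Grouping the lists by the sum of the entries
-- u + 1 gives a recursion for their generating function, with an extra parameter
-- k for the number of hooks already removed. Its solution is
-- ∏_{i=1}^{N} (1 + qⁱ) / (1 - q^{k+i}), and for k = 0 this satisfies the recursion
-- for overpartitions with parts at most N.

open import Defs
open import Data.Bool.Base using (Bool; true; false; not; T)
import Data.Bool.Properties as Bool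
open import Data.Empty using (⊥)
open import Data.Fin.Base using (Fin)
open import Data.Irrelevant using ([_])
open import Data.List.Base using (List; []; _∷_; map; _++_; replicate; length; lookup)
open import Data.List.Membership.Propositional using (_∈_)
open import Data.List.Membership.Propositional.Properties
  using (∈-map⁺; ∈-map⁻; ∈-++⁺ˡ; ∈-++⁺ʳ; ∈-++⁻; ∈-lookup)
import Data.List.Membership.DecPropositional as DecMembership
open import Data.List.Properties using (length-map; length-++; length-replicate; ∷-injective; ∷-injectiveʳ)
import Data.List.Properties as List
open import Data.List.Relation.Unary.All as All using (All; []; _∷_)
import Data.List.Relation.Unary.All.Properties as Allₚ
open import Data.List.Relation.Unary.AllPairs as AllPairs using (AllPairs; []; _∷_)
import Data.List.Relation.Unary.AllPairs.Properties as AllPairsₚ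
open import Data.List.Relation.Unary.Any using (here; there; index)
open import Data.List.Relation.Unary.Any.Properties using (lookup-index)
open import Data.List.Relation.Unary.Linked.Properties using (AllPairs⇒Linked; Linked⇒AllPairs)
open import Data.List.Relation.Unary.Unique.Propositional using (Unique)
import Data.List.Relation.Unary.Unique.Propositional.Properties as Unique
open import Data.Nat.Base
open import Data.Nat.Divisibility using (_∣_; ∣m+n∣m⇒∣n; m∣m*n; ∣1⇒≡1)
open import Data.Nat.Induction using (<-rec)
open import Data.Nat.ListAction using (sum)
open import Data.Nat.Properties
open import Data.Nat.Tactic.RingSolver using (solve-∀)
open import Data.Product.Base using (_×_; _,_; proj₁; proj₂; ∃-syntax)
import Data.Product.Properties as Product
open import Data.Refinement as Refinement using (Refinement-syntax; value)
open import Data.Refinement.Properties using (value-injective)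
open import Data.Sum.Base as Sum using (_⊎_; inj₁; inj₂)
open import Function.Base using (id)
open import Function.Bundles using (mk↔ₛ′)
open import Function.Definitions using (Injective)
open import Relation.Binary.Definitions using (DecidableEquality)
open import Relation.Binary.PropositionalEquality
open import Relation.Nullary.Decidable using (recompute; yes; no)
open import Relation.Nullary.Negation using (contradiction; ¬_)

open IsPartition
open IsOverpartition

private
  variable
    A B : Set

-- Power series and division by 1 - qʲ⁺¹.

-- A function f : ℕ → ℕ stands for the power series Σ f n qⁿ; shift j
-- multiplies it by qʲ.
shift : ℕ → (ℕ → ℕ) → ℕ → ℕ
shift zero    f n       = f n
shift (suc j) f zero    = 0
shift (suc j) f (suc n) = shift j f n

-- The exponent is positive, so coefficient `n` only sees earlier coefficients. Hence an equation f
-- = h + qʲ⁺¹ f can be handled by well-founded recursion.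
shift-cong-< : ∀ j {f h} n → (∀ {i} → i < n → f i ≡ h i) → shift (suc j) f n ≡ shift (suc j) h n
shift-cong-< j       zero    eq = refl
shift-cong-< zero    (suc n) eq = eq ≤-refl
shift-cong-< (suc j) (suc n) eq = shift-cong-< j n (λ i<n → eq (m<n⇒m<1+n i<n))

shift-cong : ∀ j {f h} → f ≗ h → shift j f ≗ shift j h
shift-cong zero    eq n = eq n
shift-cong (suc j) eq n = shift-cong-< j n (λ {i} _ → eq i)

shift-+ : ∀ j f h n → shift j (λ i → f i + h i) n ≡ shift j f n + shift j h n
shift-+ zero    f h n       = refl
shift-+ (suc j) f h zero    = refl
shift-+ (suc j) f h (suc n) = shift-+ j f h n

shift-shift : ∀ i j f n → shift i (shift j f) n ≡ shift (i + j) f n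
shift-shift zero    j f n       = refl
shift-shift (suc i) j f zero    = refl
shift-shift (suc i) j f (suc n) = shift-shift i j f n

shift-comm : ∀ i j f n → shift i (shift j f) n ≡ shift j (shift i f) n
shift-comm i j f n = begin
  shift i (shift j f) n ≡⟨ shift-shift i j f n ⟩
  shift (i + j) f n     ≡⟨ cong (λ l → shift l f n) (+-comm i j) ⟩
  shift (j + i) f n     ≡⟨ shift-shift j i f n ⟨
  shift j (shift i f) n ∎
  where open ≡-Reasoning

-- f = h / (1 - qʲ⁺¹)
IsQuotient : ℕ → (ℕ → ℕ) → (ℕ → ℕ) → Set
IsQuotient j h f = ∀ n → f n ≡ h n + shift (suc j) f n

quotient-unique : ∀ {j h f₁ f₂} → IsQuotient j h f₁ → IsQuotient j h f₂ → f₁ ≗ f₂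
quotient-unique {j} {h} {f₁} {f₂} eq₁ eq₂ = <-rec (λ n → f₁ n ≡ f₂ n) λ n rec → begin
  f₁ n                       ≡⟨ eq₁ n ⟩
  h n + shift (suc j) f₁ n   ≡⟨ cong (h n +_) (shift-cong-< j n rec) ⟩
  h n + shift (suc j) f₂ n   ≡⟨ eq₂ n ⟨
  f₂ n                       ∎
  where open ≡-Reasoning

-- The first argument is fuel; fuel t gives the coefficients of h / (1 - qʲ⁺¹) up
-- to qᵗ.
geometric : ℕ → ℕ → (ℕ → ℕ) → ℕ → ℕ
geometric zero    j h n = h n
geometric (suc t) j h n = h n + shift (suc j) (geometric t j h) n

quotient : ℕ → (ℕ → ℕ) → ℕ → ℕ
quotient j h n = geometric n j h n

geometric-stable : ∀ t t′ j h n → n ≤ t → n ≤ t′ → geometric t j h n ≡ geometric t′ j h n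
geometric-stable zero    zero     j h n    _ _ = refl
geometric-stable zero    (suc t′) j h zero _ _ = sym (+-identityʳ (h 0))
geometric-stable (suc t) zero     j h zero _ _ = +-identityʳ (h 0)
geometric-stable (suc t) (suc t′) j h n n≤t n≤t′ =
  cong (h n +_) (shift-cong-< j n λ {i} i<n →
    geometric-stable t t′ j h i (s≤s⁻¹ (≤-trans i<n n≤t)) (s≤s⁻¹ (≤-trans i<n n≤t′)))

quotient-isQuotient : ∀ j h → IsQuotient j h (quotient j h)
quotient-isQuotient j h n = begin
  geometric n j h n                       ≡⟨ geometric-stable n (suc n) j h n ≤-refl (n≤1+n n) ⟩
  h n + shift (suc j) (geometric n j h) n ≡⟨ cong (h n +_) (shift-cong-< j n λ {i} i<n →
                                               geometric-stable n i j h i (<⇒≤ i<n) ≤-refl) ⟩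
  h n + shift (suc j) (quotient j h) n    ∎
  where open ≡-Reasoning

one : ℕ → ℕ
one zero    = 1
one (suc _) = 0

-- The recursion for `F` and its product form.

-- It turns out that F N k = ∏_{i=1}^{N} (1 + qⁱ) / (1 - q^{k+i}); the recursion is the one
-- obeyed by the codes of bounded xStat below, and Q N k = F N (k+1) / (1 - q^{k+1}).
F : ℕ → ℕ → ℕ → ℕ
Q : ℕ → ℕ → ℕ → ℕ
F zero    k n = one n
F (suc N) k n = F N k n + (shift (suc N) (Q N k) n + shift (suc (k + N)) (Q N k) n)
Q N k = quotient k (F N (suc k))

Q-isQuotient : ∀ N k → IsQuotient k (F N (suc k)) (Q N k)
Q-isQuotient N k = quotient-isQuotient k (F N (suc k))

private
  -- The first and last terms of the recursion merge into `Q N k`, leaving the factor 1 + q^{N+1}.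
  -- The hypothesis is kept explicit because the induction that establishes it uses this step at the
  -- preceding `N`.
  F-factor-step : ∀ N k → IsQuotient (k + N) (F N k) (Q N k) →
                  ∀ n → F (suc N) k n ≡ Q N k n + shift (suc N) (Q N k) n
  F-factor-step N k eq n = begin
    F N k n + (a + b)   ≡⟨ lemma (F N k n) a b ⟩
    F N k n + b + a     ≡⟨ cong (_+ a) (eq n) ⟨
    Q N k n + a         ∎
    where
    open ≡-Reasoning
    a b : ℕ
    a = shift (suc N) (Q N k) n
    b = shift (suc (k + N)) (Q N k) n
    lemma : ∀ x y z → x + (y + z) ≡ x + z + y
    lemma = solve-∀

-- In product form both quotients have denominator ∏_{i=1}^{N+1} (1 - q^{k+i}): one division
-- supplies the lowest factor, the other the highest. The induction on `N` takes `R`, the right side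
-- of the wanted equation, and shows that it satisfies the equation defining `Q`; uniqueness does
-- the rest.
Q-as-quotient : ∀ N k → IsQuotient (k + N) (F N k) (Q N k)
Q-as-quotient zero    k =
  subst (λ j → IsQuotient j (F zero k) (Q zero k)) (sym (+-identityʳ k)) (Q-isQuotient zero k)
Q-as-quotient (suc N) k = λ n →
  quotient-unique {k} {F (suc N) (suc k)} {Q (suc N) k} {R} (Q-isQuotient (suc N) k) R-eq n
  where
  open ≡-Reasoning
  c d : ℕ
  c = suc k
  d = suc (k + suc N)
  R : ℕ → ℕ
  R n = F (suc N) k n + shift d (Q (suc N) k) n

  -- Subtraction-free form of (1 - qᶜ) `Q N k` = (1 - qᵈ) `Q N (suc k)`: both equal `F N (suc k)`,
  -- the first by definition of `Q`, the second by the induction hypothesis at `suc k`.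
  exchange₀ : ∀ n → Q N k n + shift d (Q N (suc k)) n ≡ Q N (suc k) n + shift c (Q N k) n
  exchange₀ n = begin
    Q N k n + y                          ≡⟨ cong (_+ y) (Q-isQuotient N k n) ⟩
    F N (suc k) n + x + y                ≡⟨ lemma (F N (suc k) n) x y ⟩
    F N (suc k) n + y + x                ≡⟨ cong (λ l → F N (suc k) n + shift (suc l) (Q N (suc k)) n + x) (+-suc k N) ⟩
    F N (suc k) n + shift (suc (suc k + N)) (Q N (suc k)) n + x
                                         ≡⟨ cong (_+ x) (Q-as-quotient N (suc k) n) ⟨
    Q N (suc k) n + x                    ∎
    where
    x y : ℕ
    x = shift c (Q N k) n
    y = shift d (Q N (suc k)) n
    lemma : ∀ x y z → x + y + z ≡ x + z + y
    lemma = solve-∀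

  -- Multiply exchange₀ by 1 + q^{N+1}.
  exchange : ∀ n → F (suc N) k n + shift d (F (suc N) (suc k)) n
                 ≡ F (suc N) (suc k) n + shift c (F (suc N) k) n
  exchange n = begin
    F (suc N) k n + shift d (F (suc N) (suc k)) n
      ≡⟨ expand (F (suc N) k) (Q N k) d (F (suc N) (suc k)) (Q N (suc k))
           (F-factor-step N k (Q-as-quotient N k))
           (F-factor-step N (suc k) (Q-as-quotient N (suc k))) n ⟩
    (Q N k n + shift d (Q N (suc k)) n)
      + shift (suc N) (λ i → Q N k i + shift d (Q N (suc k)) i) n
      ≡⟨ cong₂ _+_ (exchange₀ n) (shift-cong (suc N) exchange₀ n) ⟩
    (Q N (suc k) n + shift c (Q N k) n)
      + shift (suc N) (λ i → Q N (suc k) i + shift c (Q N k) i) n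
      ≡⟨ expand (F (suc N) (suc k)) (Q N (suc k)) c (F (suc N) k) (Q N k)
           (F-factor-step N (suc k) (Q-as-quotient N (suc k)))
           (F-factor-step N k (Q-as-quotient N k)) n ⟨
    F (suc N) (suc k) n + shift c (F (suc N) k) n ∎
    where
    expand : ∀ f p j h r → (∀ n → f n ≡ p n + shift (suc N) p n) →
             (∀ n → h n ≡ r n + shift (suc N) r n) →
             ∀ n → f n + shift j h n
                 ≡ (p n + shift j r n) + shift (suc N) (λ i → p i + shift j r i) n
    expand f p j h r f-eq h-eq n = begin
      f n + shift j h n
        ≡⟨ cong₂ _+_ (f-eq n) (trans (shift-cong j h-eq n) (shift-+ j r (shift (suc N) r) n)) ⟩
      (p n + shift (suc N) p n) + (shift j r n + shift j (shift (suc N) r) n)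
        ≡⟨ cong (λ l → (p n + shift (suc N) p n) + (shift j r n + l)) (shift-comm j (suc N) r n) ⟩
      (p n + shift (suc N) p n) + (shift j r n + shift (suc N) (shift j r) n)
        ≡⟨ swap (p n) _ _ _ ⟩
      (p n + shift j r n) + (shift (suc N) p n + shift (suc N) (shift j r) n)
        ≡⟨ cong ((p n + shift j r n) +_) (shift-+ (suc N) p (shift j r) n) ⟨
      (p n + shift j r n) + shift (suc N) (λ i → p i + shift j r i) n ∎
      where
      swap : ∀ w x y z → (w + x) + (y + z) ≡ (w + y) + (x + z)
      swap = solve-∀

  R-eq : IsQuotient k (F (suc N) (suc k)) R
  R-eq n = begin
    F (suc N) k n + shift d (Q (suc N) k) n
      ≡⟨ cong (F (suc N) k n +_) (trans (shift-cong d (Q-isQuotient (suc N) k) n)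
           (shift-+ d (F (suc N) (suc k)) (shift c (Q (suc N) k)) n)) ⟩
    F (suc N) k n + (shift d (F (suc N) (suc k)) n + shift d (shift c (Q (suc N) k)) n)
      ≡⟨ +-assoc (F (suc N) k n) _ _ ⟨
    (F (suc N) k n + shift d (F (suc N) (suc k)) n) + shift d (shift c (Q (suc N) k)) n
      ≡⟨ cong₂ _+_ (exchange n) (shift-comm d c (Q (suc N) k) n) ⟩
    (F (suc N) (suc k) n + shift c (F (suc N) k) n) + shift c (shift d (Q (suc N) k)) n
      ≡⟨ +-assoc (F (suc N) (suc k) n) _ _ ⟩
    F (suc N) (suc k) n + (shift c (F (suc N) k) n + shift c (shift d (Q (suc N) k)) n)
      ≡⟨ cong (F (suc N) (suc k) n +_) (shift-+ c (F (suc N) k) (shift d (Q (suc N) k)) n) ⟨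
    F (suc N) (suc k) n + shift c R n ∎

F-factor : ∀ N k n → F (suc N) k n ≡ Q N k n + shift (suc N) (Q N k) n
F-factor N k = F-factor-step N k (Q-as-quotient N k)

-- Finite enumerations and cardinality.

record Enumeration (P : A → Set) (k : ℕ) : Set where
  field
    elements : List A
    unique   : Unique elements
    sound    : ∀ {x} → x ∈ elements → P x
    complete : ∀ {x} → P x → x ∈ elements
    count    : length elements ≡ k

open Enumeration

lookup-unique-injective : {xs : List A} → Unique xs → ∀ {x} (p q : x ∈ xs) → index p ≡ index q
lookup-unique-injective (_ ∷ _)   (here refl) (here refl) = refl
lookup-unique-injective (x∉ ∷ _)  (here refl) (there q)   = contradiction refl (All.lookup x∉ q)
lookup-unique-injective (x∉ ∷ _)  (there p)   (here refl) = contradiction refl (All.lookup x∉ p)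
lookup-unique-injective (_ ∷ uxs) (there p)   (there q)   =
  cong Fin.suc (lookup-unique-injective uxs p q)

index-∈-lookup : (xs : List A) (i : Fin (length xs)) → index (∈-lookup {xs = xs} i) ≡ i
index-∈-lookup (x ∷ xs) Fin.zero    = refl
index-∈-lookup (x ∷ xs) (Fin.suc i) = cong Fin.suc (index-∈-lookup xs i)

enumeration⇒cardinality : DecidableEquality A → {P : A → Set} → ∀ {k} →
                          Enumeration P k → HasCardinality [ x ∈ A ∣ P x ] k
enumeration⇒cardinality {A} _≟_ {P} record
  { elements = xs ; unique = uxs ; sound = sound ; complete = complete ; count = refl } =
  mk↔ₛ′ to from to-from from-to
  where
  open DecMembership _≟_ using (_∈?_)
  member : (r : [ x ∈ A ∣ P x ]) → value r ∈ xs
  -- The proof `px` is irrelevant and cannot yield an index, so membership is recomputed by deciding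
  -- it.
  member (x Refinement., [ px ]) = recompute (x ∈? xs) (complete px)
  to : [ x ∈ A ∣ P x ] → Fin (length xs)
  to r = index (member r)
  from : Fin (length xs) → [ x ∈ A ∣ P x ]
  from i = lookup xs i Refinement., [ sound (∈-lookup i) ]
  to-from : ∀ i → to (from i) ≡ i
  to-from i = trans (lookup-unique-injective uxs _ (∈-lookup i)) (index-∈-lookup xs i)
  from-to : ∀ r → from (to r) ≡ r
  from-to r = value-injective (sym (lookup-index (member r)))

enum-cong : {P Q : A → Set} → (∀ {x} → P x → Q x) → (∀ {x} → Q x → P x) →
            ∀ {k} → Enumeration P k → Enumeration Q k
enum-cong P⇒Q Q⇒P e = record
  { elements = elements e ; unique = unique e ; sound = λ x∈ → P⇒Q (sound e x∈)
  ; complete = λ q → complete e (Q⇒P q) ; count = count e }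

enum-⊥ : {P : A → Set} → (∀ {x} → P x → ⊥) → Enumeration P 0
enum-⊥ ¬P = record
  { elements = [] ; unique = [] ; sound = λ () ; complete = λ p → contradiction p ¬P ; count = refl }

enum-singleton : (x : A) → Enumeration (_≡ x) 1
enum-singleton x = record
  { elements = x ∷ [] ; unique = [] ∷ [] ; sound = λ { (here eq) → eq } ; complete = here ; count = refl }

enum-⊎ : {P Q : A → Set} → (∀ {x} → P x → Q x → ⊥) → ∀ {k l} →
         Enumeration P k → Enumeration Q l → Enumeration (λ x → P x ⊎ Q x) (k + l)
enum-⊎ disjoint e₁ e₂ = record
  { elements = elements e₁ ++ elements e₂
  ; unique   = Unique.++⁺ (unique e₁) (unique e₂) λ (x∈₁ , x∈₂) → disjoint (sound e₁ x∈₁) (sound e₂ x∈₂)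
  ; sound    = λ x∈ → Sum.map (sound e₁) (sound e₂) (∈-++⁻ (elements e₁) x∈)
  ; complete = λ { (inj₁ p) → ∈-++⁺ˡ (complete e₁ p) ; (inj₂ q) → ∈-++⁺ʳ (elements e₁) (complete e₂ q) }
  ; count    = trans (length-++ (elements e₁)) (cong₂ _+_ (count e₁) (count e₂))
  }

Image : (A → B) → (A → Set) → B → Set
Image φ P y = ∃[ x ] (P x × y ≡ φ x)

enum-image : {P : A → Set} {φ : A → B} → Injective _≡_ _≡_ φ →
             ∀ {k} → Enumeration P k → Enumeration (Image φ P) k
enum-image {φ = φ} inj e = record
  { elements = map φ (elements e)
  ; unique   = Unique.map⁺ inj (unique e)
  ; sound    = λ y∈ → let x , x∈ , eq = ∈-map⁻ φ y∈ in x , sound e x∈ , eq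
  ; complete = λ { (x , px , refl) → ∈-map⁺ φ (complete e px) }
  ; count    = trans (length-map φ (elements e)) (count e)
  }

-- Counting by weight.

-- f is the generating function of the elements of C by weight.
CountsAt : (A → Set) → (A → ℕ) → (ℕ → ℕ) → ℕ → Set
CountsAt C wt f n = Enumeration (λ x → C x × wt x ≡ n) (f n)

Counts : (A → Set) → (A → ℕ) → (ℕ → ℕ) → Set
Counts C wt f = ∀ n → CountsAt C wt f n

-- The equation `n ≡ j + i` is passed to the supplier of enumerations, so that for positive `j` a
-- recursion on the weight can serve as supplier.
enum-shift : ∀ j n {P : ℕ → A → Set} {f} → (∀ {i} → n ≡ j + i → Enumeration (P i) (f i)) →
             Enumeration (λ x → ∃[ i ] (n ≡ j + i × P i x)) (shift j f n)
enum-shift zero    n       e = enum-cong (λ p → n , refl , p) (λ { (_ , refl , p) → p }) (e refl)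
enum-shift (suc j) zero    e = enum-⊥ λ ()
enum-shift (suc j) (suc n) {P} {f} e =
  enum-cong (λ { (i , refl , p) → i , refl , p }) (λ { (i , refl , p) → i , refl , p })
    (enum-shift j n {P} {f} (λ eq → e (cong suc eq)))

module _ {C : A → Set} {wt : A → ℕ} {φ : A → B} {wt′ : B → ℕ} {f : ℕ → ℕ} (j : ℕ)
         (inj : Injective _≡_ _≡_ φ) (wt-φ : ∀ {x} → C x → wt′ (φ x) ≡ j + wt x) where

  counts-imageAt : ∀ {n} → (∀ {i} → n ≡ j + i → CountsAt C wt f i) →
                   CountsAt (Image φ C) wt′ (shift j f) n
  counts-imageAt {n = n} e =
    enum-cong
      (λ { (x , (i , eq , cx , refl) , refl) → (x , cx , refl) , trans (wt-φ cx) (sym eq) })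
      (λ { ((x , cx , refl) , eq) → x , (wt x , trans (sym eq) (wt-φ cx) , cx , refl) , refl })
      (enum-image inj (enum-shift j n {λ i x → C x × wt x ≡ i} e))

  counts-image : Counts C wt f → Counts (Image φ C) wt′ (shift j f)
  counts-image e n = counts-imageAt (λ {i} _ → e i)

counts-⊎At : {C D E : A → Set} {wt : A → ℕ} {f h : ℕ → ℕ} {n : ℕ} → (∀ {x} → C x → D x → ⊥) →
             (∀ {x} → C x → E x) → (∀ {x} → D x → E x) → (∀ {x} → E x → C x ⊎ D x) →
             CountsAt C wt f n → CountsAt D wt h n →
             CountsAt E wt (λ n → f n + h n) n
counts-⊎At disj C⇒E D⇒E E⇒ e₁ e₂ =
  enum-cong
    (λ { (inj₁ (c , eq)) → C⇒E c , eq ; (inj₂ (d , eq)) → D⇒E d , eq })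
    (λ { (e , eq) → Sum.map (_, eq) (_, eq) (E⇒ e) })
    (enum-⊎ (λ { (c , _) (d , _) → disj c d }) e₁ e₂)

-- Overpartitions with bounded parts.

-- AtMost N: the overpartitions with parts at most N. AtMost⁺ N: those with parts
-- at most N + 1 in which N + 1 is not overlined.
data AtMost : ℕ → List (ℕ × Bool) → Set
data AtMost⁺ : ℕ → List (ℕ × Bool) → Set

data AtMost where
  empty    : AtMost 0 []
  plain    : ∀ {N os} → AtMost⁺ N os → AtMost (suc N) os
  overline : ∀ {N os} → AtMost⁺ N os → AtMost (suc N) ((suc N , true) ∷ os)

data AtMost⁺ where
  below  : ∀ {N os} → AtMost N os → AtMost⁺ N os
  repeat : ∀ {N os} → AtMost⁺ N os → AtMost⁺ N ((suc N , false) ∷ os)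

size : List (ℕ × Bool) → ℕ
size os = sum (map proj₁ os)

AtMost-≤ : ∀ {N os} → AtMost N os → All (λ x → proj₁ x ≤ N) os
AtMost⁺-≤ : ∀ {N os} → AtMost⁺ N os → All (λ x → proj₁ x ≤ suc N) os
AtMost-≤ empty        = []
AtMost-≤ (plain m)    = AtMost⁺-≤ m
AtMost-≤ (overline m) = ≤-refl ∷ AtMost⁺-≤ m
AtMost⁺-≤ (below u)  = All.map m≤n⇒m≤1+n (AtMost-≤ u)
AtMost⁺-≤ (repeat m) = ≤-refl ∷ AtMost⁺-≤ m

AtMost⁺-overlined-≢ : ∀ {N os} → AtMost⁺ N os → All (λ x → T (proj₂ x) → suc N ≢ proj₁ x) os
AtMost⁺-overlined-≢ (below u)  = All.map (λ x≤N _ eq → <⇒≢ (s≤s x≤N) (sym eq)) (AtMost-≤ u)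
AtMost⁺-overlined-≢ (repeat m) = (λ ()) ∷ AtMost⁺-overlined-≢ m

module _ {N : ℕ} where

  -- Removing a leading plain `suc N` stays in the class, so its series X satisfies X = F N 0 +
  -- q^{N+1} X, which is `Q-as-quotient` at k = 0.
  AtMost⁺-countsAt : Counts (AtMost N) size (F N 0) → ∀ n → CountsAt (AtMost⁺ N) size (Q N 0) n
  AtMost⁺-countsAt AtMost-counts = <-rec (CountsAt (AtMost⁺ N) size (Q N 0)) λ n rec →
    subst (Enumeration _) (sym (Q-as-quotient N 0 n))
      (counts-⊎At {f = F N 0} {h = shift (suc N) (Q N 0)}
        (λ { u (_ , _ , refl) → 1+n≰n (All.head (AtMost-≤ u)) })
        below (λ { (_ , m , refl) → repeat m })
        (λ { (below u) → inj₁ u ; (repeat m) → inj₂ (_ , m , refl) })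
        (AtMost-counts n)
        (counts-imageAt {f = Q N 0} (suc N) ∷-injectiveʳ (λ _ → refl) λ { {i} refl → rec (s≤s (m≤n+m i N)) }))

  -- Only the first `suc N` may be overlined; this one binary choice is the factor 1 + q^{N+1} of
  -- `F-factor`.
  AtMost-counts-suc : Counts (AtMost⁺ N) size (Q N 0) → Counts (AtMost (suc N)) size (F (suc N) 0)
  AtMost-counts-suc AtMost⁺-counts n =
    subst (Enumeration _) (sym (F-factor N 0 n))
      (counts-⊎At {f = Q N 0} {h = shift (suc N) (Q N 0)}
        (λ { m (_ , _ , refl) → All.head (AtMost⁺-overlined-≢ m) _ refl })
        plain (λ { (_ , m , refl) → overline m })
        (λ { (plain m) → inj₁ m ; (overline m) → inj₂ (_ , m , refl) })
        (AtMost⁺-counts n)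
        (counts-image {f = Q N 0} (suc N) ∷-injectiveʳ (λ _ → refl) AtMost⁺-counts n))

AtMost-counts : ∀ N → Counts (AtMost N) size (F N 0)
AtMost-counts zero    zero    = enum-cong (λ { refl → empty , refl }) (λ { (empty , _) → refl })
                                  (enum-singleton [])
AtMost-counts zero    (suc n) = enum-⊥ λ { (empty , ()) }
AtMost-counts (suc N)         = AtMost-counts-suc (AtMost⁺-countsAt (AtMost-counts N))

record IsOver (os : List (ℕ × Bool)) : Set where
  constructor over
  field
    weaklyDecreasing   : AllPairs (λ x y → proj₁ x ≥ proj₁ y) os
    allPositive        : All (λ x → 0 < proj₁ x) os
    onlyFirstOverlined : AllPairs (λ x y → T (proj₂ y) → proj₁ x ≢ proj₁ y) os

AtMost⇒Over : ∀ {N os} → AtMost N os → IsOver os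
AtMost⁺⇒Over : ∀ {N os} → AtMost⁺ N os → IsOver os
AtMost⇒Over empty        = over [] [] []
AtMost⇒Over (plain m)    = AtMost⁺⇒Over m
AtMost⇒Over (overline m) = let over d p o = AtMost⁺⇒Over m in
  over (AtMost⁺-≤ m ∷ d) (z<s ∷ p) (AtMost⁺-overlined-≢ m ∷ o)
AtMost⁺⇒Over (below u)  = AtMost⇒Over u
AtMost⁺⇒Over (repeat m) = let over d p o = AtMost⁺⇒Over m in
  over (AtMost⁺-≤ m ∷ d) (z<s ∷ p) (AtMost⁺-overlined-≢ m ∷ o)

Over⇒AtMost : ∀ N {os} → IsOver os → All (λ x → proj₁ x ≤ N) os → AtMost N os
Over⇒AtMost⁺ : ∀ N {os} → IsOver os → All (λ x → proj₁ x ≤ suc N) os →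
               All (λ x → T (proj₂ x) → suc N ≢ proj₁ x) os → AtMost⁺ N os
Over⇒AtMost zero {[]} _ _ = empty
Over⇒AtMost zero {_ ∷ _} (over _ (0<p ∷ _) _) (p≤0 ∷ _) = contradiction p≤0 (<⇒≱ 0<p)
Over⇒AtMost (suc N) {[]} o _ = plain (Over⇒AtMost⁺ N o [] [])
Over⇒AtMost (suc N) {(p , b) ∷ os} (over (d ∷ ds) (q ∷ qs) (l ∷ ls)) (p≤ ∷ os≤) with p ≟ suc N | b
... | yes refl | true  = overline (Over⇒AtMost⁺ N (over ds qs ls) os≤ l)
... | yes refl | false = plain (Over⇒AtMost⁺ N (over (d ∷ ds) (q ∷ qs) (l ∷ ls)) (p≤ ∷ os≤) ((λ ()) ∷ l))
-- The head is the largest part, so if it misses `suc N` then every part does.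
... | no p≢    | _     = plain (Over⇒AtMost⁺ N (over (d ∷ ds) (q ∷ qs) (l ∷ ls)) (p≤ ∷ os≤)
    ((λ _ eq → p≢ (sym eq)) ∷ All.map (λ x≤p _ eq → p≢ (≤-antisym p≤ (≤-trans (≤-reflexive eq) x≤p))) d))
Over⇒AtMost⁺ N {[]} o _ _ = below (Over⇒AtMost N o [])
Over⇒AtMost⁺ N {(p , b) ∷ os} (over (d ∷ ds) (q ∷ qs) (l ∷ ls)) (p≤ ∷ os≤) (x ∷ xs) with p ≟ suc N | b
... | yes refl | true  = contradiction refl (x _)
... | yes refl | false = repeat (Over⇒AtMost⁺ N (over ds qs ls) os≤ xs)
... | no p≢    | _     = below (Over⇒AtMost N (over (d ∷ ds) (q ∷ qs) (l ∷ ls)) (p≤N ∷ All.map (λ y≤p → ≤-trans y≤p p≤N) d))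
  where
  p≤N : p ≤ N
  p≤N = s≤s⁻¹ (≤∧≢⇒< p≤ p≢)

parts≤sum : ∀ ps → All (_≤ sum ps) ps
parts≤sum []       = []
parts≤sum (p ∷ ps) = m≤m+n p (sum ps) ∷ All.map (λ x≤ → ≤-trans x≤ (m≤n+m (sum ps) p)) (parts≤sum ps)

-- No part exceeds the total, so the bound `n` on the parts costs nothing.
overpartition-enumeration : ∀ n → Enumeration (IsOverpartition n) (F n 0 n)
overpartition-enumeration n = enum-cong
  (λ { (u , eq) → let over d p o = AtMost⇒Over u in record
    { partition = record
      { decreasing = AllPairs⇒Linked (AllPairsₚ.map⁺ d) ; positive = Allₚ.map⁺ p ; total = eq }
    ; overlines = o } })
  (λ {os} o → let π = partition o in
    Over⇒AtMost n
      (over (AllPairsₚ.map⁻ (Linked⇒AllPairs (λ x≥y y≥z → ≤-trans y≥z x≥y) (decreasing π)))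
            (Allₚ.map⁻ (positive π)) (overlines o))
      (Allₚ.map⁻ (subst (λ s → All (_≤ s) (map proj₁ os)) (total π) (parts≤sum (map proj₁ os))))
    , total π)
  (AtMost-counts n n)

-- Codes and their generating function.

-- In (s₁ , u₁ , v₁) ∷ (s₂ , u₂ , v₂) ∷ …, outermost hook first, the i-th arm and leg
-- exceed the next ones by 2uᵢ + sᵢ₊₁ + 1 and 2vᵢ + sᵢ₊₁ + 1. The innermost hook has
-- arm 2u + s₁ and leg 2v + (1 - s₁), so s₁ is stored far from where it is used;
-- this gives the i-th entry the position weight i - 1 for s uniformly.
Code : Set
Code = List (Bool × ℕ × ℕ)

bit : Bool → ℕ
bit false = 0
bit true  = 1

-- For a nonempty code, `xStat` plus `yStat` minus the head bit is half the outermost hook length.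
-- The head bit drops out because it only decides which of the innermost arm and leg is odd.
xStat yStat halfSize : Code → ℕ
xStat []                  = 0
xStat ((_ , u , _) ∷ L)   = suc (u + xStat L)
yStat []                  = 0
yStat ((s , _ , v) ∷ L)   = bit s + v + yStat L
halfSize []               = 0
halfSize ((_ , u , v) ∷ L) = suc (u + xStat L) + (v + yStat L) + halfSize L

-- L contributes yStat L to the half length of each of the k hooks further out,
-- apart from its contribution through xStat, which weight k does not count.
weight : ℕ → Code → ℕ
weight k L = halfSize L + k * yStat L

-- Here the head of the code is known up to its entry v.
weight⁺ : ℕ → ℕ × Code → ℕ
weight⁺ k (v , L) = suc k * v + weight (suc k) L

-- The middle entry is the one that brings `xStat` to exactly `suc N` when `xStat L ≤ N`.
insert : ℕ → Bool → ℕ × Code → Code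
insert N s (v , L) = (s , N ∸ xStat L , v) ∷ L

insert-injective : ∀ {N s} → Injective _≡_ _≡_ (insert N s)
insert-injective eq with refl , refl ← ∷-injective eq = refl

-- The entry `v` and the tail's `yStat` count in the head hook and in the `k` hooks outside it,
-- whence `suc k`; the bit `s` counts only in the latter.
weight-insert : ∀ N s k {vL} → xStat (proj₂ vL) ≤ N →
                weight k (insert N s vL) ≡ suc N + k * bit s + weight⁺ k vL
weight-insert N s k {v , L} le = begin
  suc (N ∸ xStat L + xStat L) + (v + yStat L) + halfSize L + k * (bit s + v + yStat L)
    ≡⟨ cong (λ l → suc l + (v + yStat L) + halfSize L + k * (bit s + v + yStat L)) (m∸n+n≡m le) ⟩
  suc N + (v + yStat L) + halfSize L + k * (bit s + v + yStat L)
    ≡⟨ lemma N v (yStat L) (halfSize L) k (bit s) ⟩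
  suc N + k * bit s + weight⁺ k (v , L) ∎
  where
  open ≡-Reasoning
  lemma : ∀ N v y h k b → suc N + (v + y) + h + k * (b + v + y) ≡
                          suc N + k * b + (suc k * v + (h + suc k * y))
  lemma = solve-∀

Bounded : ℕ → Code → Set
Bounded N L = xStat L ≤ N

Bounded⁺ : ℕ → ℕ × Code → Set
Bounded⁺ N vL = xStat (proj₂ vL) ≤ N

-- Raising `v` by one costs `suc k`, so the free choice of `v` is a division by 1 - q^{k+1}.
bounded⁺-counts : ∀ N k → Counts (Bounded N) (weight (suc k)) (F N (suc k)) →
                  Counts (Bounded⁺ N) (weight⁺ k) (Q N k)
bounded⁺-counts N k e = <-rec (CountsAt (Bounded⁺ N) (weight⁺ k) (Q N k)) λ n rec →
  subst (Enumeration _) (sym (Q-isQuotient N k n))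
    (counts-⊎At {f = F N (suc k)} {h = shift (suc k) (Q N k)}
      (λ { (_ , _ , refl) (_ , _ , ()) })
      (λ { (_ , le , refl) → le })
      (λ { (_ , le , refl) → le })
      (λ { {zero , L} le → inj₁ (L , le , refl) ; {suc v , L} le → inj₂ ((v , L) , le , refl) })
      (counts-image {φ = 0 ,_} {f = F N (suc k)} 0 (λ { refl → refl })
        (λ {L} _ → cong (_+ weight (suc k) L) (*-zeroʳ (suc k))) e n)
      (counts-imageAt {φ = λ (v , L) → suc v , L} {f = Q N k} (suc k) (λ { refl → refl })
        (λ { {v , L} _ → lemma k v (weight (suc k) L) })
        λ { {i} refl → rec (s≤s (m≤n+m i k)) }))
  where
  lemma : ∀ k v w → suc k * suc v + w ≡ suc k + (suc k * v + w)
  lemma = solve-∀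

-- Either `xStat` stays within `N`, or it is `suc N` and the code is an `insert`, whose two bits
-- give the two shifts of `Q N k`. The tail then has one more hook outside it, so the induction on
-- `N` runs over all `k`.
bounded-counts : ∀ N k → Counts (Bounded N) (weight k) (F N k)
bounded-counts zero k zero = enum-cong
  (λ { refl → z≤n , *-zeroʳ k }) (λ { {[]} _ → refl }) (enum-singleton [])
bounded-counts zero k (suc n) = enum-⊥ λ
  { {[]} (_ , eq) → contradiction (trans (sym eq) (*-zeroʳ k)) λ () }
bounded-counts (suc N) k n =
  counts-⊎At {f = F N k} {h = λ i → shift (suc N) (Q N k) i + shift (suc (k + N)) (Q N k) i}
    disjoint m≤n⇒m≤1+n
    (λ { (inj₁ (_ , le , refl)) → top-≤ le ; (inj₂ (_ , le , refl)) → top-≤ le })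
    split
    (bounded-counts N k n)
    (counts-⊎At {f = shift (suc N) (Q N k)} {h = shift (suc (k + N)) (Q N k)}
      (λ { (_ , _ , refl) (_ , _ , ()) })
      inj₁ inj₂ id
      (counts-image {f = Q N k} (suc N) insert-injective
        (λ {vL} le → trans (weight-insert N false k le) (cong (_+ weight⁺ k vL) (lemma₀ N k))) Q-counts n)
      (counts-image {f = Q N k} (suc (k + N)) insert-injective
        (λ {vL} le → trans (weight-insert N true k le) (cong (_+ weight⁺ k vL) (lemma₁ N k))) Q-counts n))
  where
  Q-counts : Counts (Bounded⁺ N) (weight⁺ k) (Q N k)
  Q-counts = bounded⁺-counts N k (bounded-counts N (suc k))

  Top : Bool → Code → Set
  Top s = Image (insert N s) (Bounded⁺ N)

  top-≡ : ∀ {L} → xStat L ≤ N → suc (N ∸ xStat L + xStat L) ≡ suc N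
  top-≡ le = cong suc (m∸n+n≡m le)

  top-≤ : ∀ {L} → xStat L ≤ N → suc (N ∸ xStat L + xStat L) ≤ suc N
  top-≤ {L} le = ≤-reflexive (top-≡ {L} le)

  disjoint : ∀ {L} → Bounded N L → ¬ (Top false L ⊎ Top true L)
  disjoint b (inj₁ ((v , L) , le , refl)) = 1+n≰n (≤-trans (≤-reflexive (sym (top-≡ {L} le))) b)
  disjoint b (inj₂ ((v , L) , le , refl)) = 1+n≰n (≤-trans (≤-reflexive (sym (top-≡ {L} le))) b)

  split : ∀ {L} → Bounded (suc N) L → Bounded N L ⊎ (Top false L ⊎ Top true L)
  split {[]} _ = inj₁ z≤n
  split {(s , u , v) ∷ L} le with u + xStat L ≟ N
  ... | no ≢N = inj₁ (≤∧≢⇒< (s≤s⁻¹ le) ≢N)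
  ... | yes refl with s
  ...   | false = inj₂ (inj₁ ((v , L) , m≤n+m _ u , cong (λ l → (false , l , v) ∷ L) (sym (m+n∸n≡m u (xStat L)))))
  ...   | true  = inj₂ (inj₂ ((v , L) , m≤n+m _ u , cong (λ l → (true , l , v) ∷ L) (sym (m+n∸n≡m u (xStat L)))))

  lemma₀ : ∀ N k → suc N + k * 0 ≡ suc N
  lemma₀ = solve-∀
  lemma₁ : ∀ N k → suc N + k * 1 ≡ suc (k + N)
  lemma₁ = solve-∀

-- Adding and removing an outer hook.

IsShape : List ℕ → Set
IsShape ps = AllPairs _≥_ ps × All (0 <_) ps

inflate : ℕ → List ℕ → List ℕ
inflate q ps = map suc ps ++ replicate q 1

-- Adds a hook with p cells to the right of the old first row, q cells below
-- the old first column, and one cell in the corner.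
addHook : ℕ → ℕ → List ℕ → List ℕ
addHook p q ps = (row ps 0 + suc p) ∷ inflate q ps

deflate : List ℕ → List ℕ
deflate (suc (suc x) ∷ ps) = suc x ∷ deflate ps
deflate _                  = []

-- Positive parts become at least 2, so `deflate` stops exactly at the appended ones.
deflate-inflate : ∀ q {ps} → All (0 <_) ps → deflate (inflate q ps) ≡ ps
deflate-inflate zero    []                   = refl
deflate-inflate (suc q) []                   = refl
deflate-inflate q       (_∷_ {x = suc x} _ pos) = cong (suc x ∷_) (deflate-inflate q pos)

length-inflate : ∀ q ps → length (inflate q ps) ≡ length ps + q
length-inflate q ps = trans (length-++ (map suc ps)) (cong₂ _+_ (length-map suc ps) (length-replicate q))

sum-inflate : ∀ q ps → sum (inflate q ps) ≡ sum ps + length ps + q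
sum-inflate zero    []       = refl
sum-inflate (suc q) []       = cong suc (sum-inflate q [])
sum-inflate q       (p ∷ ps) = trans (cong (suc p +_) (sum-inflate q ps)) (lemma p (sum ps) (length ps) q)
  where
  lemma : ∀ p s l q → suc p + (s + l + q) ≡ p + s + suc l + q
  lemma = solve-∀

-- Deflating the tail recovers `ps`; then the length gives `q` and the head gives `p`.
addHook-injective : ∀ {p p′ q q′ ps ps′} → All (0 <_) ps → All (0 <_) ps′ →
                    addHook p q ps ≡ addHook p′ q′ ps′ → p ≡ p′ × q ≡ q′ × ps ≡ ps′
addHook-injective {p} {p′} {q} {q′} {ps} {ps′} pos pos′ eq
  with head-eq , tail-eq ← ∷-injective eq
  with refl ← trans (sym (deflate-inflate q pos)) (trans (cong deflate tail-eq) (deflate-inflate q′ pos′)) =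
    suc-injective (+-cancelˡ-≡ (row ps 0) _ _ head-eq)
  , +-cancelˡ-≡ (length ps) _ _
      (trans (sym (length-inflate q ps)) (trans (cong length tail-eq) (length-inflate q′ ps)))
  , refl

replicate-≥ : ∀ q (x : ℕ) → AllPairs _≥_ (replicate q x)
replicate-≥ zero    x = []
replicate-≥ (suc q) x = Allₚ.replicate⁺ q ≤-refl ∷ replicate-≥ q x

head-≥ : ∀ {ps} → AllPairs _≥_ ps → All (_≤ row ps 0) ps
head-≥ []       = []
head-≥ (x≥ ∷ _) = ≤-refl ∷ x≥

row≤row₀ : ∀ {ps} → AllPairs _≥_ ps → ∀ i → row ps i ≤ row ps 0
row≤row₀ dec i = go (head-≥ dec) i
  where
  go : ∀ {n ps} → All (_≤ n) ps → ∀ i → row ps i ≤ n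
  go []       _       = z≤n
  go (x≤ ∷ _) zero    = x≤
  go (_ ∷ xs) (suc i) = go xs i

addHook-isShape : ∀ p q {ps} → IsShape ps → IsShape (addHook p q ps)
addHook-isShape p q {ps} (dec , pos) =
    (Allₚ.++⁺ (Allₚ.map⁺ (All.map (λ {x} x≤ → suc≤top x≤) (head-≥ dec))) (Allₚ.replicate⁺ q (suc≤top z≤n))
      ∷ AllPairsₚ.++⁺ (AllPairsₚ.map⁺ (AllPairs.map s≤s dec)) (replicate-≥ q 1)
          (Allₚ.map⁺ (All.universal (λ x → Allₚ.replicate⁺ q (s≤s z≤n)) ps)))
  , (≤-trans z<s (m≤n+m (suc p) (row ps 0)) ∷ Allₚ.++⁺ (Allₚ.map⁺ (All.universal (λ _ → z<s) ps)) (Allₚ.replicate⁺ q z<s))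
  where
  suc≤top : ∀ {x} → x ≤ row ps 0 → suc x ≤ row ps 0 + suc p
  suc≤top {x} x≤ = ≤-trans (s≤s (≤-trans x≤ (m≤m+n _ p))) (≤-reflexive (sym (+-suc (row ps 0) p)))

-- Once a row of length 1 is met, all later rows are 1 by monotonicity, and their number is `q`.
inflate-surjective : ∀ {ps} → IsShape ps → ∃[ q ] ∃[ ps′ ] (IsShape ps′ × inflate q ps′ ≡ ps)
inflate-surjective {[]} _ = 0 , [] , ([] , []) , refl
inflate-surjective {suc zero ∷ ps} (x≥ ∷ dec , _ ∷ pos) =
  suc (length ps) , [] , ([] , []) , cong (1 ∷_) (ones x≥ pos)
  where
  ones : ∀ {ps} → All (_≤ 1) ps → All (0 <_) ps → replicate (length ps) 1 ≡ ps
  ones []         []         = refl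
  ones (x≤1 ∷ xs) (0<x ∷ ys) = cong₂ _∷_ (≤-antisym 0<x x≤1) (ones xs ys)
inflate-surjective {suc (suc x) ∷ ps} (x≥ ∷ dec , _ ∷ pos)
  with q , ps′ , (dec′ , pos′) , refl ← inflate-surjective (dec , pos) =
    q , suc x ∷ ps′ , (All.map s≤s⁻¹ (Allₚ.map⁻ (Allₚ.++⁻ˡ (map suc ps′) x≥)) ∷ dec′ , z<s ∷ pos′) , refl

-- The length bound is the measure that lets decoding recurse on the inner diagram.
addHook-surjective : ∀ {x ps} → IsShape (x ∷ ps) →
                     ∃[ p ] ∃[ q ] ∃[ ps′ ] (IsShape ps′ × length ps′ ≤ length ps × addHook p q ps′ ≡ x ∷ ps)
addHook-surjective {x} {ps} (x≥ ∷ dec , 0<x ∷ pos)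
  with q , ps′ , shape , refl ← inflate-surjective (dec , pos) =
    x ∸ suc (row ps′ 0) , q , ps′ , shape
  , ≤-trans (m≤m+n (length ps′) q) (≤-reflexive (sym (length-inflate q ps′)))
  , cong (_∷ inflate q ps′) (trans (+-suc (row ps′ 0) _) (m+[n∸m]≡n (row₀< ps′ x≥)))
  where
  row₀< : ∀ ps → All (_≤ x) (inflate q ps) → row ps 0 < x
  row₀< []      _        = 0<x
  row₀< (_ ∷ _) (y< ∷ _) = y<

-- Principal hooks under `addHook`.

col₀ : ∀ {ps} → All (0 <_) ps → col ps 0 ≡ length ps
col₀ pos = cong length (List.filter-all (0 <?_) pos)

col-ones : ∀ q j → col (replicate q 1) (suc j) ≡ 0
col-ones zero    j = refl
col-ones (suc q) j = col-ones q j

col-inflate : ∀ q ps j → col (inflate q ps) (suc j) ≡ col ps j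
col-inflate q []       j = col-ones q j
col-inflate q (p ∷ ps) j with j <ᵇ p
... | true  = cong suc (col-inflate q ps j)
... | false = col-inflate q ps j

row-inflate : ∀ q ps i → 1 < row (inflate q ps) i → row (inflate q ps) i ≡ suc (row ps i)
row-inflate zero    []       i       ()
row-inflate (suc q) []       zero    (s≤s ())
row-inflate (suc q) []       (suc i) 1<r = row-inflate q [] i 1<r
row-inflate q       (p ∷ ps) zero    1<r = refl
row-inflate q       (p ∷ ps) (suc i) 1<r = row-inflate q ps i 1<r

row-inflate-cell : ∀ q ps i → 0 < row ps i → row (inflate q ps) i ≡ suc (row ps i)
row-inflate-cell q (p ∷ ps) zero    _   = refl
row-inflate-cell q (p ∷ ps) (suc i) 0<r = row-inflate-cell q ps i 0<r

hookLength-corner : ∀ p q {ps} → All (0 <_) ps →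
                    hookLength (addHook p q ps) 0 0 ≡ row ps 0 + length ps + suc (p + q)
hookLength-corner p q {ps} pos = begin
  (row ps 0 + suc p ∸ 1) + (col (addHook p q ps) 0 ∸ 1) + 1
    ≡⟨ cong₂ (λ a b → (a ∸ 1) + (b ∸ 1) + 1) (+-suc (row ps 0) p) (col₀ pos′) ⟩
  row ps 0 + p + length (inflate q ps) + 1
    ≡⟨ cong (λ l → row ps 0 + p + l + 1) (length-inflate q ps) ⟩
  row ps 0 + p + (length ps + q) + 1
    ≡⟨ lemma (row ps 0) p (length ps) q ⟩
  row ps 0 + length ps + suc (p + q) ∎
  where
  open ≡-Reasoning
  pos′ : All (0 <_) (addHook p q ps)
  pos′ = ≤-trans z<s (m≤n+m (suc p) (row ps 0)) ∷
         Allₚ.++⁺ (Allₚ.map⁺ (All.universal (λ _ → z<s) ps)) (Allₚ.replicate⁺ q z<s)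
  lemma : ∀ r p l q → r + p + (l + q) + 1 ≡ r + l + suc (p + q)
  lemma = solve-∀

-- The cell moves one step down the diagonal while its row and column each grow by one, so arm and
-- leg are unchanged.
hookLength-inner : ∀ p q {ps} → AllPairs _≥_ ps → ∀ i → IsCell ps i i →
                   hookLength (addHook p q ps) (suc i) (suc i) ≡ hookLength ps i i
hookLength-inner p q {ps} dec i cell =
  cong₂ (λ a b → (a ∸ suc (suc i)) + (b ∸ suc (suc i)) + 1) row-eq col-eq
  where
  row-eq : row (inflate q ps) i ≡ suc (row ps i)
  row-eq = row-inflate-cell q ps i (≤-trans z<s cell)
  -- The new top row reaches column `suc i` and supplies its extra cell.
  i<top : suc i < row ps 0 + suc p
  i<top = ≤-trans (s≤s (≤-trans cell (≤-trans (row≤row₀ dec i) (m≤m+n _ p))))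
                  (≤-reflexive (sym (+-suc (row ps 0) p)))
  col-eq : col (addHook p q ps) (suc i) ≡ suc (col ps i)
  col-eq = trans (cong length (List.filter-accept (suc i <?_) i<top)) (cong suc (col-inflate q ps i))

cell-inner : ∀ p q {ps} i → IsCell (addHook p q ps) (suc i) (suc i) → IsCell ps i i
cell-inner p q {ps} i cell =
  s≤s⁻¹ (≤-trans cell (≤-reflexive (row-inflate q ps i (≤-trans (s≤s z<s) cell))))

inner-cell : ∀ p q {ps} i → IsCell ps i i → IsCell (addHook p q ps) (suc i) (suc i)
inner-cell p q {ps} i cell =
  ≤-trans (s≤s cell) (≤-reflexive (sym (row-inflate-cell q ps i (≤-trans z<s cell))))

addHook-even : ∀ p q {ps} → IsShape ps → 2 ∣ row ps 0 + length ps + suc (p + q) →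
               EvenPrincipalHooks ps → EvenPrincipalHooks (addHook p q ps)
addHook-even p q (_ , pos) 2∣ even zero    _    = subst (2 ∣_) (sym (hookLength-corner p q pos)) 2∣
addHook-even p q {ps} (dec , _) 2∣ even (suc i) cell =
  let cell′ = cell-inner p q {ps} i cell in
  subst (2 ∣_) (sym (hookLength-inner p q dec i cell′)) (even i cell′)

addHook-even⁻ : ∀ p q {ps} → IsShape ps → EvenPrincipalHooks (addHook p q ps) →
                2 ∣ row ps 0 + length ps + suc (p + q) × EvenPrincipalHooks ps
addHook-even⁻ p q {ps} (dec , pos) even =
    subst (2 ∣_) (hookLength-corner p q pos) (even 0 (≤-trans z<s (m≤n+m (suc p) (row ps 0))))
  , λ i cell → subst (2 ∣_) (hookLength-inner p q dec i cell) (even (suc i) (inner-cell p q {ps} i cell))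

-- Parities and halves.

-- Recursion in steps of two, rather than the formula of `gap-≡`, lets halving with remainder go by
-- pattern matching.
gap : Bool → ℕ → ℕ
gap s zero    = bit s
gap s (suc u) = suc (suc (gap s u))

gap-≡ : ∀ s u → gap s u ≡ bit s + 2 * u
gap-≡ s zero    = sym (+-identityʳ (bit s))
gap-≡ s (suc u) = trans (cong (λ l → suc (suc l)) (gap-≡ s u)) (lemma (bit s) u)
  where
  lemma : ∀ b u → suc (suc (b + 2 * u)) ≡ b + 2 * suc u
  lemma = solve-∀

gap-injective : ∀ {s s′} u u′ → gap s u ≡ gap s′ u′ → s ≡ s′ × u ≡ u′
gap-injective {false} {false} zero zero _ = refl , refl
gap-injective {true}  {true}  zero zero _ = refl , refl
gap-injective {false} {true}  zero zero ()
gap-injective {true}  {false} zero zero ()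
gap-injective {false} {_}     zero (suc _) ()
gap-injective {true}  {_}     zero (suc _) ()
gap-injective {_}     {false} (suc _) zero ()
gap-injective {_}     {true}  (suc _) zero ()
gap-injective (suc u) (suc u′) eq with refl , refl ← gap-injective u u′ (suc-injective (suc-injective eq)) =
  refl , refl

gap-surjective : ∀ n → ∃[ s ] ∃[ u ] n ≡ gap s u
gap-surjective zero          = false , 0 , refl
gap-surjective (suc zero)    = true , 0 , refl
gap-surjective (suc (suc n)) with s , u , refl ← gap-surjective n = s , suc u , refl

¬2∣odd : ∀ n → ¬ 2 ∣ 2 * n + 1
¬2∣odd n 2∣ with () ← ∣1⇒≡1 (∣m+n∣m⇒∣n 2∣ (m∣m*n n))

gap-sum : ∀ s u t v → gap s u + gap t v ≡ bit s + bit t + 2 * (u + v)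
gap-sum s u t v = trans (cong₂ _+_ (gap-≡ s u) (gap-≡ t v)) (lemma (bit s) (bit t) u v)
  where
  lemma : ∀ a b u v → a + 2 * u + (b + 2 * v) ≡ a + b + 2 * (u + v)
  lemma = solve-∀

-- For a hook around a nonempty decoded diagram: row plus column of that diagram is odd, so an even
-- hook length forces an even sum of gaps.
even-gap-sum : ∀ s u t v → 2 ∣ gap s u + gap t v → t ≡ s
even-gap-sum false u false v _ = refl
even-gap-sum true  u true  v _ = refl
even-gap-sum false u true  v 2∣ =
  contradiction (subst (2 ∣_) (trans (gap-sum false u true v) (+-comm 1 (2 * (u + v)))) 2∣) (¬2∣odd (u + v))
even-gap-sum true  u false v 2∣ =
  contradiction (subst (2 ∣_) (trans (gap-sum true u false v) (+-comm 1 (2 * (u + v)))) 2∣) (¬2∣odd (u + v))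

-- For the innermost hook, whose length is one more than the sum of the gaps.
odd-gap-sum : ∀ s u t v → 2 ∣ suc (gap s u + gap t v) → t ≡ not s
odd-gap-sum false u false v 2∣ =
  contradiction (subst (2 ∣_) (trans (cong suc (gap-sum false u false v)) (+-comm 1 (2 * (u + v)))) 2∣) (¬2∣odd (u + v))
odd-gap-sum true  u true  v 2∣ =
  contradiction (subst (2 ∣_) (trans (cong suc (gap-sum true u true v)) (lemma (u + v))) 2∣) (¬2∣odd (suc (u + v)))
  where
  lemma : ∀ n → suc (2 + 2 * n) ≡ 2 * suc n + 1
  lemma = solve-∀
odd-gap-sum false u true  v _ = refl
odd-gap-sum true  u false v _ = refl

-- The bijection from codes to partitions.

-- `b` is the outermost entry's bit, carried inward to the innermost hook; every other hook takes
-- its bit from the next entry.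
chain : Bool → ℕ → ℕ → Code → List ℕ
chain b u v []                   = addHook (gap b u) (gap (not b) v) []
chain b u v ((s , u′ , v′) ∷ L) = addHook (gap s u) (gap s v) (chain b u′ v′ L)

decode : Code → List ℕ
decode []                 = []
decode ((b , u , v) ∷ L) = chain b u v L

chain-isShape : ∀ b u v L → IsShape (chain b u v L)
chain-isShape b u v []                   = addHook-isShape (gap b u) (gap (not b) v) ([] , [])
chain-isShape b u v ((s , u′ , v′) ∷ L) = addHook-isShape (gap s u) (gap s v) (chain-isShape b u′ v′ L)

chain≢[] : ∀ b u v L → chain b u v L ≢ []
chain≢[] b u v []      ()
chain≢[] b u v (_ ∷ _) ()

-- `addHook-injective` peels both codes in step; they end together because only the innermost hook
-- surrounds an empty diagram.
chain-injective : ∀ {b b′ u u′ v v′} L L′ → chain b u v L ≡ chain b′ u′ v′ L′ →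
                  (b , u , v) ∷ L ≡ (b′ , u′ , v′) ∷ L′
chain-injective {u = u} {u′} {v} {v′} [] [] eq
  with p-eq , q-eq , _ ← addHook-injective [] [] eq
  with refl , refl ← gap-injective u u′ p-eq
  with _ , refl ← gap-injective v v′ q-eq = refl
chain-injective {b′ = b′} [] ((_ , u , v) ∷ L′) eq
  with _ , _ , ps-eq ← addHook-injective [] (proj₂ (chain-isShape b′ u v L′)) eq
  = contradiction (sym ps-eq) (chain≢[] b′ u v L′)
chain-injective {b} ((_ , u , v) ∷ L) [] eq
  with _ , _ , ps-eq ← addHook-injective (proj₂ (chain-isShape b u v L)) [] eq
  = contradiction ps-eq (chain≢[] b u v L)
chain-injective {b} {b′} {u} {u′} {v} {v′} ((_ , x , y) ∷ L) ((_ , x′ , y′) ∷ L′) eq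
  with p-eq , q-eq , ps-eq ← addHook-injective (proj₂ (chain-isShape b x y L)) (proj₂ (chain-isShape b′ x′ y′ L′)) eq
  with refl , refl ← gap-injective u u′ p-eq
  with _ , refl ← gap-injective v v′ q-eq
  with refl ← chain-injective L L′ ps-eq = refl

decode-injective : Injective _≡_ _≡_ decode
decode-injective {[]} {[]} _ = refl
decode-injective {[]} {(b , u , v) ∷ L} eq = contradiction (sym eq) (chain≢[] b u v L)
decode-injective {(b , u , v) ∷ L} {[]} eq = contradiction eq (chain≢[] b u v L)
decode-injective {_ ∷ L} {_ ∷ L′} eq = chain-injective L L′ eq

halfHook : ℕ → ℕ → Code → ℕ
halfHook u v L = suc (u + xStat L) + (v + yStat L)

-- First row and first column share the corner, so their sum exceeds the outermost hook length by
-- one.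
chain-semiperimeter : ∀ b u v L → row (chain b u v L) 0 + length (chain b u v L) ≡ suc (2 * halfHook u v L)
-- The left side is the length of the next hook outward, as in `hookLength-corner`. The two gaps
-- share the bit `s`, which is why `yStat` counts it once after halving.
chain-hook : ∀ b s u v u′ v′ L →
  row (chain b u′ v′ L) 0 + length (chain b u′ v′ L) + suc (gap s u + gap s v) ≡ 2 * halfHook u v ((s , u′ , v′) ∷ L)

single-hook : ∀ b u v → suc (gap b u + gap (not b) v) ≡ 2 * halfHook u v []
single-hook b u v = trans (cong suc (gap-sum b u (not b) v)) (trans (cong (λ l → suc (l + 2 * (u + v))) (bits b)) (lemma u v))
  where
  bits : ∀ b → bit b + bit (not b) ≡ 1
  bits false = refl
  bits true  = refl
  lemma : ∀ u v → suc (1 + 2 * (u + v)) ≡ 2 * (suc (u + 0) + (v + 0))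
  lemma = solve-∀

chain-hook b s u v u′ v′ L = trans
  (cong₂ (λ x y → x + suc y) (chain-semiperimeter b u′ v′ L) (gap-sum s u s v))
  (lemma (bit s) u v u′ v′ (xStat L) (yStat L))
  where
  lemma : ∀ b u v u′ v′ x y → suc (2 * (suc (u′ + x) + (v′ + y))) + suc (b + b + 2 * (u + v))
                            ≡ 2 * (suc (u + suc (u′ + x)) + (v + (b + v′ + y)))
  lemma = solve-∀

addHook-semiperimeter : ∀ p q ps → row (addHook p q ps) 0 + length (addHook p q ps) ≡
                        suc (row ps 0 + length ps + suc (p + q))
addHook-semiperimeter p q ps = trans (cong (λ l → row ps 0 + suc p + suc l) (length-inflate q ps))
  (lemma (row ps 0) p (length ps) q)
  where
  lemma : ∀ r p l q → r + suc p + suc (l + q) ≡ suc (r + l + suc (p + q))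
  lemma = solve-∀

chain-semiperimeter b u v [] = trans (addHook-semiperimeter (gap b u) (gap (not b) v) []) (cong suc (single-hook b u v))
chain-semiperimeter b u v ((s , u′ , v′) ∷ L) =
  trans (addHook-semiperimeter (gap s u) (gap s v) (chain b u′ v′ L)) (cong suc (chain-hook b s u v u′ v′ L))

sum-addHook : ∀ p q ps → sum (addHook p q ps) ≡ row ps 0 + length ps + suc (p + q) + sum ps
sum-addHook p q ps = trans (cong (row ps 0 + suc p +_) (sum-inflate q ps))
  (lemma (row ps 0) p q (sum ps) (length ps))
  where
  lemma : ∀ r p q s l → r + suc p + (s + l + q) ≡ r + l + suc (p + q) + s
  lemma = solve-∀

-- The principal hooks partition the diagram, so the half lengths add up to half the size.
sum-chain : ∀ b u v L → sum (chain b u v L) ≡ 2 * (halfHook u v L + halfSize L)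
sum-chain b u v [] = trans (sum-addHook (gap b u) (gap (not b) v) [])
  (trans (cong (_+ 0) (single-hook b u v)) (lemma (halfHook u v [])))
  where
  lemma : ∀ h → 2 * h + 0 ≡ 2 * (h + 0)
  lemma = solve-∀
sum-chain b u v ((s , u′ , v′) ∷ L) = trans (sum-addHook (gap s u) (gap s v) (chain b u′ v′ L))
  (trans (cong₂ _+_ (chain-hook b s u v u′ v′ L) (sum-chain b u′ v′ L))
    (sym (*-distribˡ-+ 2 (halfHook u v ((s , u′ , v′) ∷ L)) (halfHook u′ v′ L + halfSize L))))

sum-decode : ∀ L → sum (decode L) ≡ 2 * halfSize L
sum-decode []                 = refl
sum-decode ((b , u , v) ∷ L) = sum-chain b u v L

even-double : ∀ {n} h → n ≡ 2 * h → 2 ∣ n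
even-double h refl = m∣m*n h

chain-even : ∀ b u v L → EvenPrincipalHooks (chain b u v L)
chain-even b u v [] = addHook-even (gap b u) (gap (not b) v) ([] , [])
  (even-double (halfHook u v []) (single-hook b u v)) λ _ ()
chain-even b u v ((s , u′ , v′) ∷ L) = addHook-even (gap s u) (gap s v) (chain-isShape b u′ v′ L)
  (even-double (halfHook u v ((s , u′ , v′) ∷ L)) (chain-hook b s u v u′ v′ L)) (chain-even b u′ v′ L)

decode-isShape : ∀ L → IsShape (decode L)
decode-isShape []                = [] , []
decode-isShape ((b , u , v) ∷ L) = chain-isShape b u v L

decode-even : ∀ L → EvenPrincipalHooks (decode L)
decode-even []                = λ _ ()
decode-even ((b , u , v) ∷ L) = chain-even b u v L

private
  2h+1+g+1≡2[h+1]+g : ∀ h g → suc (2 * h) + suc g ≡ 2 * suc h + g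
  2h+1+g+1≡2[h+1]+g = solve-∀

-- Strips the outer hook and decodes what is left. The fuel `n` bounds the number of rows, since the
-- inner diagram is not a sublist.
decode-surjective : ∀ n {ps} → length ps ≤ n → IsShape ps → EvenPrincipalHooks ps → ∃[ L ] ps ≡ decode L
decode-surjective _       {[]}     _         _     _    = [] , refl
decode-surjective (suc n) {x ∷ ps} (s≤s len) shape even
  with p , q , ps′ , shape′ , len′ , refl ← addHook-surjective shape
  with 2∣ , even′ ← addHook-even⁻ p q shape′ even
  with decode-surjective n (≤-trans len′ len) shape′ even′
-- Nothing is inside, so the parities of `p` and `q` differ and the bit of `p` records both.
... | [] , refl
  with b , u , refl ← gap-surjective p
  with t , v , refl ← gap-surjective q
  with refl ← odd-gap-sum b u t v 2∣ = (b , u , v) ∷ [] , refl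
-- Here `p` and `q` share a parity `s`. The innermost bit `b` moves from the old head to the new
-- one, and `s` takes its place.
... | (b , u′ , v′) ∷ L , refl
  with s , u , refl ← gap-surjective p
  with t , v , refl ← gap-surjective q
  with refl ← even-gap-sum s u t v (∣m+n∣m⇒∣n
         (subst (2 ∣_) (trans (cong (_+ suc (gap s u + gap t v)) (chain-semiperimeter b u′ v′ L)) (2h+1+g+1≡2[h+1]+g (halfHook u′ v′ L) _)) 2∣)
         (m∣m*n (suc (halfHook u′ v′ L)))) = (b , u , v) ∷ (s , u′ , v′) ∷ L , refl

-- The common count.

-- Makes the bound `m` automatic for codes of half size `m`.
xStat≤halfSize : ∀ L → xStat L ≤ halfSize L
xStat≤halfSize []                = z≤n
xStat≤halfSize ((_ , u , v) ∷ L) = ≤-trans (m≤m+n _ (v + yStat L)) (m≤m+n _ (halfSize L))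

evenHook-enumeration : ∀ m → Enumeration (λ ps → IsPartition (2 * m) ps × EvenPrincipalHooks ps) (F m 0 m)
evenHook-enumeration m = enum-cong
  (λ { (L , (_ , eq) , refl) → let dec , pos = decode-isShape L in
      record { decreasing = AllPairs⇒Linked dec ; positive = pos
             ; total = trans (sum-decode L) (cong (2 *_) (trans (sym (+-identityʳ _)) eq)) }
    , decode-even L })
  (λ {ps} (π , even) → complete′ π even)
  (enum-image decode-injective (bounded-counts m 0 m))
  where
  complete′ : ∀ {ps} → IsPartition (2 * m) ps → EvenPrincipalHooks ps →
              Image decode (λ L → Bounded m L × weight 0 L ≡ m) ps
  complete′ {ps} π even
    with L , refl ← decode-surjective (length ps) ≤-refl
           (Linked⇒AllPairs (λ x≥y y≥z → ≤-trans y≥z x≥y) (decreasing π) , positive π) even =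
    L , (subst (xStat L ≤_) eq (xStat≤halfSize L) , trans (+-identityʳ _) eq) , refl
    where
    eq : halfSize L ≡ m
    eq = *-cancelˡ-≡ (halfSize L) m 2 (trans (sym (sum-decode L)) (total π))

corollary5p4 : (m : ℕ) →
    ∃[ k ] (HasCardinality (EvenHookPartition (2 * m)) k × HasCardinality (Overpartition m) k)
-- Both sides are the coefficient of qᵐ in ∏_{i=1}^{m} (1 + qⁱ) / (1 - qⁱ).
corollary5p4 m = F m 0 m
  , enumeration⇒cardinality (List.≡-dec _≟_) (evenHook-enumeration m)
  , enumeration⇒cardinality (List.≡-dec (Product.≡-dec _≟_ Bool._≟_)) (overpartition-enumeration m)
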